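{- Let $w$ and $w'$ be two Dyck paths in $\mathscr{D}_n$ such that $w\leq w'$ in the dexter order. Then $w$ is smaller than (or equal to) $w'$ in the Tamari order on $\mathscr{D}_n$.
   Context: A Dyck path of size $n\geq 0$ is a word of length $2n$ in the letters $0,1$ with $n$ letters $1$ and $n$ letters $0$ such that every prefix contains at least as many $1$'s as $0$'s (the height after a prefix is its number of $1$'s minus its number of $0$'s). Let $\mathscr{D}_n$ be the set of Dyck paths of size $n$. A subpath of a Dyck path $w$ is a non-empty sequence $x$ of consecutive letters of $w$ that starts and ends at the same height and stays strictly above that height in between. A subpath $x$ is movable in $w$ if it is immediately preceded in $w$ by the letter $0$ and either $x$ ends at the last letter of $w$ or $x$ is immediately followed in $w$ by the letter $1$. For a movable subpath $x$, let $N=N(w,x)\geq 1$ be the number of consecutive letters $0$ just before $x$, so $w=a\,0^{N}\,x\,b$ where $a$ does not end with $0$; for $1\leq i\leq N$ let $M(w,x,i)=a\,0^{N-i}\,x\,0^{i}\,b\in\mathscr{D}_n$. Let $\Gamma_n$ be the directed graph on $\mathscr{D}_n$ with edges $w\to M(w,x,i)$ for all movable $x$ in $w$ and all $1\leq i\leq N(w,x)$. The dexter order is: $u\leq v$ if and only if there is a directed path (possibly of length $0$) from $u$ to $v$ in $\Gamma_n$. This is a partial order whose cover relations are exactly the edges of $\Gamma_n$. The Tamari order on $\mathscr{D}_n$ is the reflexive-transitive closure of the moves $a\,0\,x\,b\to a\,x\,0\,b$, where $x$ is a subpath (immediately preceded by a letter $0$) of the Dyck path $a\,0\,x\,b$.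 -}

module Defs where

open import Data.Digit using (Bit; 0b; 1b)
open import Data.Fin.Properties using (_≟_)
open import Data.Integer using (ℤ; _⊖_; _<_)
open import Data.List using (List; []; _∷_; _++_; _∷ʳ_; filter; length; replicate)
open import Data.Nat using (ℕ; _*_; _∸_; _≤_)
open import Data.Product using (∃; _×_)
open import Data.Sum using (_⊎_)
open import Relation.Binary.Construct.Closure.ReflexiveTransitive using (Star)
open import Relation.Binary.PropositionalEquality using (_≡_; _≢_)
open import Relation.Nullary using (¬_)

Word : Set
Word = List Bit

occurrences : Bit → Word → ℕ
occurrences c w = length (filter (c ≟_) w)

height : Word → ℤ
height w = occurrences 1b w ⊖ occurrences 0b w

EndsWith0 : Word → Set
EndsWith0 w = ∃ λ c → w ≡ c ∷ʳ 0b

StartsWith1 : Word → Set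
StartsWith1 w = ∃ λ c → w ≡ 1b ∷ c

-- The proof fields are irrelevant, so that two Dyck paths are equal as soon
-- as their words are.
record DyckPath (n : ℕ) : Set where
  constructor mkDyckPath
  field
    word         : Word
    .length≡2n   : length word ≡ 2 * n
    .ones≡n      : occurrences 1b word ≡ n
    .zeros≡n     : occurrences 0b word ≡ n
    .prefixes    : ∀ p s → word ≡ p ++ s → occurrences 0b p ≤ occurrences 1b p

open DyckPath public using (word)

-- A subpath is an occurrence of a factor: the position in w, given by the
-- letters before and after it, is part of the data.
record Subpath (w : Word) : Set where
  constructor mkSubpath
  field
    before factor after : Word
    split    : w ≡ before ++ factor ++ after
    nonEmpty : factor ≢ []
    level    : height (before ++ factor) ≡ height before
    above    : ∀ p s → factor ≡ p ++ s → p ≢ [] → s ≢ [] →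
               height before < height (before ++ p)

open Subpath public

Movable : {w : Word} → Subpath w → Set
Movable x = EndsWith0 (before x) × (after x ≡ [] ⊎ StartsWith1 (after x))

-- The field maximal forces N to be the number of consecutive letters 0 just
-- before x.
record DexterEdge {n : ℕ} (w w′ : DyckPath n) : Set where
  constructor mkDexterEdge
  field
    x       : Subpath (word w)
    movable : Movable x
    a       : Word
    N       : ℕ
    zeros   : before x ≡ a ++ replicate N 0b
    maximal : ¬ EndsWith0 a
    i       : ℕ
    1≤i     : 1 ≤ i
    i≤N     : i ≤ N
    target  : word w′ ≡
              a ++ replicate (N ∸ i) 0b ++ factor x ++ replicate i 0b ++ after x

record TamariMove {n : ℕ} (w w′ : DyckPath n) : Set where
  constructor mkTamariMove
  field
    x      : Subpath (word w)
    a      : Word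
    zero   : before x ≡ a ∷ʳ 0b
    target : word w′ ≡ a ++ factor x ++ 0b ∷ after x

infix 4 _≤ᵈ_ _≤ᵗ_

_≤ᵈ_ : {n : ℕ} → DyckPath n → DyckPath n → Set
_≤ᵈ_ = Star DexterEdge

_≤ᵗ_ : {n : ℕ} → DyckPath n → DyckPath n → Set
_≤ᵗ_ = Star TamariMove

{-# OPTIONS --safe #-}
-- Moving the arch x to the left across i letters 0 is the same as moving it
-- i times across a single letter 0, and each of these steps is a Tamari move.
-- The intermediate words are Dyck paths because moving an arch to the left
-- across a letter 0 can only raise the heights along the path.
module Submission where

open import Algebra.Bundles using (AbelianGroup)
open import Algebra.Properties.Group using (∙-cancelˡ)
open import Defs
open import Data.Digit using (0b; 1b)
open import Data.Fin.Properties using (_≟_)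
open import Data.Integer as ℤ using (0ℤ; _⊖_; +_)
import Data.Integer.Properties as ℤ
open import Data.Integer.Tactic.RingSolver using (solve-∀)
open import Data.List using (List; []; _∷_; _++_; _∷ʳ_; filter; length; replicate)
open import Data.List.Properties
  using (++-assoc; ++-identityʳ; ∷ʳ-++; ∷-injective; length-++; filter-++)
open import Data.List.Relation.Binary.Permutation.Propositional using (_↭_; ↭-sym)
open import Data.List.Relation.Binary.Permutation.Propositional.Properties
  using (↭-length; filter-↭; shift; ++⁺ˡ)
open import Data.Nat using (ℕ; zero; suc; _+_; _∸_; _≤_; s≤s)
open import Data.Product using (∃-syntax; _×_; _,_)
open import Data.Sum using (_⊎_; inj₁; inj₂)
open import Level using (Level)
open import Relation.Binary.Construct.Closure.ReflexiveTransitive using (ε; _◅_; _⋆)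
open import Relation.Binary.PropositionalEquality

private variable
  a : Level
  n : ℕ

-- Locates where the prefix `ps` ends. If it ends exactly with `xs`, the second alternative is
-- returned, with empty `ts`.
++-≡-++ : {A : Set a} (xs {ys} ps {ss} : List A) → xs ++ ys ≡ ps ++ ss →
          (∃[ ts ] xs ≡ ps ++ ts) ⊎ (∃[ ts ] ps ≡ xs ++ ts × ys ≡ ts ++ ss)
++-≡-++ []       ps       eq = inj₂ (ps , refl , eq)
++-≡-++ (x ∷ xs) []       eq = inj₁ (x ∷ xs , refl)
++-≡-++ (x ∷ xs) (p ∷ ps) eq with ∷-injective eq
... | refl , eq′ with ++-≡-++ xs ps eq′
...   | inj₁ (ts , refl)       = inj₁ (ts , refl)
...   | inj₂ (ts , refl , eq″) = inj₂ (ts , refl , eq″)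

-- `replicate` exposes its first letter, whereas the letter to be crossed is the last one of the
-- block.
replicate-++-∷ : {A : Set a} (k : ℕ) (c : A) (xs : List A) →
                 replicate k c ++ c ∷ xs ≡ c ∷ replicate k c ++ xs
replicate-++-∷ zero    c xs = refl
replicate-++-∷ (suc k) c xs = cong (c ∷_) (replicate-++-∷ k c xs)

⊖-+-interchange : ∀ k l m n → (k + m) ⊖ (l + n) ≡ (k ⊖ l) ℤ.+ (m ⊖ n)
⊖-+-interchange k l m n = begin
  (k + m) ⊖ (l + n)                     ≡⟨ ℤ.[+m]-[+n]≡m⊖n (k + m) (l + n) ⟨
  (+ k ℤ.+ + m) ℤ.- (+ l ℤ.+ + n)       ≡⟨ interchange (+ k) (+ l) (+ m) (+ n) ⟩
  (+ k ℤ.- + l) ℤ.+ (+ m ℤ.- + n)       ≡⟨ cong₂ ℤ._+_ (ℤ.[+m]-[+n]≡m⊖n k l) (ℤ.[+m]-[+n]≡m⊖n m n) ⟩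
  (k ⊖ l) ℤ.+ (m ⊖ n)                   ∎
  where
  open ≡-Reasoning
  interchange : ∀ a b c d → (a ℤ.+ c) ℤ.- (b ℤ.+ d) ≡ (a ℤ.- b) ℤ.+ (c ℤ.- d)
  interchange = solve-∀

0≤m⊖n⇒n≤m : ∀ m n → 0ℤ ℤ.≤ m ⊖ n → n ≤ m
0≤m⊖n⇒n≤m m n 0≤m⊖n =
  ℤ.drop‿+≤+ (ℤ.0≤i-j⇒j≤i (subst (0ℤ ℤ.≤_) (sym (ℤ.[+m]-[+n]≡m⊖n m n)) 0≤m⊖n))

n≤m⇒0≤m⊖n : ∀ m n → n ≤ m → 0ℤ ℤ.≤ m ⊖ n
n≤m⇒0≤m⊖n m n n≤m =
  subst (0ℤ ℤ.≤_) (ℤ.[+m]-[+n]≡m⊖n m n) (ℤ.i≤j⇒0≤j-i (ℤ.+≤+ n≤m))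

occurrences-++ : ∀ c u v → occurrences c (u ++ v) ≡ occurrences c u + occurrences c v
occurrences-++ c u v =
  trans (cong length (filter-++ (c ≟_) u v)) (length-++ (filter (c ≟_) u))

occurrences-↭ : ∀ c {u v} → u ↭ v → occurrences c u ≡ occurrences c v
occurrences-↭ c u↭v = ↭-length (filter-↭ (c ≟_) u↭v)

height-++ : ∀ u v → height (u ++ v) ≡ height u ℤ.+ height v
height-++ u v = trans
  (cong₂ _⊖_ (occurrences-++ 1b u v) (occurrences-++ 0b u v))
  (⊖-+-interchange (occurrences 1b u) (occurrences 0b u) (occurrences 1b v) (occurrences 0b v))

height-↭ : ∀ {u v} → u ↭ v → height u ≡ height v
height-↭ u↭v = cong₂ _⊖_ (occurrences-↭ 1b u↭v) (occurrences-↭ 0b u↭v)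

-- The conditions on a subpath with heights measured from its own start, so that they do not depend
-- on its position and survive a move.
record Arch (x : Word) : Set where
  field
    nonEmpty : x ≢ []
    level    : height x ≡ 0ℤ
    above    : ∀ p s → x ≡ p ++ s → p ≢ [] → s ≢ [] → 0ℤ ℤ.< height p

-- Heights add under concatenation, so the height of `before x` cancels from both conditions.
factor-arch : ∀ {w} (x : Subpath w) → Arch (factor x)
factor-arch x = record
  { nonEmpty = Subpath.nonEmpty x
  ; level    = ∙-cancelˡ (AbelianGroup.group ℤ.+-0-abelianGroup) h _ _
      (trans (sym (height-++ (before x) (factor x)))
        (trans (Subpath.level x) (sym (ℤ.+-identityʳ h))))
  ; above    = λ p s eq p≢[] s≢[] → ℤ.≰⇒> λ hp≤0 →
      ℤ.<⇒≱ (Subpath.above x p s eq p≢[] s≢[])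
        (subst₂ ℤ._≤_ (sym (height-++ (before x) p)) (ℤ.+-identityʳ h)
          (ℤ.+-monoʳ-≤ h hp≤0))
  }
  where
  h = height (before x)

module _ {x : Word} (arch : Arch x) where

  arch-subpath : ∀ {w} c {b} → w ≡ c ++ x ++ b → Subpath w
  arch-subpath c {b} eq = mkSubpath c x b eq (Arch.nonEmpty arch)
    (trans (height-++ c x) (trans (cong (λ z → height c ℤ.+ z) (Arch.level arch)) (ℤ.+-identityʳ _)))
    λ p s x≡ps p≢[] s≢[] → subst₂ ℤ._<_ (ℤ.+-identityʳ _) (sym (height-++ c p))
      (ℤ.+-monoʳ-< (height c) (Arch.above arch p s x≡ps p≢[] s≢[]))

  -- The two extreme prefixes, empty and full, have height zero; `above` covers the others.
  arch-prefix : ∀ p s → x ≡ p ++ s → 0ℤ ℤ.≤ height p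
  arch-prefix []      s       eq = ℤ.≤-refl
  arch-prefix (l ∷ p) []      eq = ℤ.≤-reflexive
    (sym (trans (cong height (sym (trans eq (++-identityʳ _)))) (Arch.level arch)))
  arch-prefix (l ∷ p) (m ∷ s) eq = ℤ.<⇒≤ (Arch.above arch (l ∷ p) (m ∷ s) eq (λ ()) (λ ()))

  -- Letter counts, and with them total heights, depend on a word only up to permutation.
  shift-↭ : ∀ c b → c ++ x ++ 0b ∷ b ↭ c ++ 0b ∷ x ++ b
  shift-↭ c b = ++⁺ˡ c (shift 0b x b)

  shift-prefixes : ∀ c b →
    (∀ p s → c ++ 0b ∷ x ++ b ≡ p ++ s → 0ℤ ℤ.≤ height p) →
    (∀ p s → c ++ x ++ 0b ∷ b ≡ p ++ s → 0ℤ ℤ.≤ height p)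
  shift-prefixes c b nonneg p s eq with ++-≡-++ c p eq
  ... | inj₁ (t , refl) = nonneg p (t ++ 0b ∷ x ++ b) (++-assoc p t _)
  ... | inj₂ (t , refl , eq′) with ++-≡-++ x t eq′
  -- The prefix ends inside `x`: it climbs from the height of `c`, itself a prefix of the old word,
  -- by a prefix of the arch.
  ...   | inj₁ (r , x≡tr) =
          subst (0ℤ ℤ.≤_) (sym (height-++ c t))
            (ℤ.+-mono-≤ (nonneg c _ refl) (arch-prefix t r x≡tr))
  -- The prefix stops right after `x`, before the moved `0b`.
  ...   | inj₂ ([] , refl , _) =
          subst (0ℤ ℤ.≤_) (sym (height-++ c (x ++ [])))
            (ℤ.+-mono-≤ (nonneg c _ refl)
              (arch-prefix (x ++ []) [] (sym (trans (++-identityʳ _) (++-identityʳ x)))))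
  -- The prefix contains the moved `0b`, so it permutes the old prefix of the same length and has
  -- the same height.
  ...   | inj₂ (_ ∷ r , refl , eq″) with ∷-injective eq″
  ...     | refl , refl =
            subst (0ℤ ℤ.≤_) (height-↭ (↭-sym (shift-↭ c r)))
              (nonneg (c ++ 0b ∷ x ++ r) s
                (sym (trans (++-assoc c _ s) (cong (λ z → c ++ 0b ∷ z) (++-assoc x r s)))))

  shift-path : (w : DyckPath n) → ∀ c b → word w ≡ c ++ 0b ∷ x ++ b → DyckPath n
  shift-path (mkDyckPath _ length≡2n ones≡n zeros≡n prefixes) c b eq = mkDyckPath
    (c ++ x ++ 0b ∷ b)
    (trans (↭-length (shift-↭ c b)) (trans (cong length (sym eq)) length≡2n))
    (trans (occurrences-↭ 1b (shift-↭ c b)) (trans (cong (occurrences 1b) (sym eq)) ones≡n))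
    (trans (occurrences-↭ 0b (shift-↭ c b)) (trans (cong (occurrences 0b) (sym eq)) zeros≡n))
    (λ p s eq₁ → 0≤m⊖n⇒n≤m _ _ (shift-prefixes c b
      (λ q t eq₂ → n≤m⇒0≤m⊖n _ _ (prefixes q t (trans eq eq₂))) p s eq₁))

  shift-move : (w : DyckPath n) → ∀ c b (eq : word w ≡ c ++ 0b ∷ x ++ b) →
               TamariMove w (shift-path w c b eq)
  shift-move w c b eq =
    mkTamariMove (arch-subpath (c ∷ʳ 0b) (trans eq (sym (∷ʳ-++ c 0b (x ++ b))))) c refl refl

  shift-zeros : (w w′ : DyckPath n) → ∀ a b {k i} → i ≤ k →
                word w ≡ a ++ replicate k 0b ++ x ++ b →
                word w′ ≡ a ++ replicate (k ∸ i) 0b ++ x ++ replicate i 0b ++ b →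
                w ≤ᵗ w′
  -- Equal words suffice to identify `w` with `w′`, since the other fields are irrelevant.
  shift-zeros w w′ a b {i = zero} _ eq eq′ with trans eq (sym eq′)
  ... | refl = ε
  shift-zeros w w′ a b {suc k} {suc i} (s≤s i≤k) eq eq′ =
    -- The crossed `0b` joins the tail, so both counters drop by one and the number of zeros finally
    -- left before `x` is unchanged.
    shift-move w c b eq₀ ◅ shift-zeros (shift-path w c b eq₀) w′ a (0b ∷ b) i≤k
      (++-assoc a _ _)
      (trans eq′ (cong (λ z → a ++ replicate (k ∸ i) 0b ++ x ++ z) (sym (replicate-++-∷ i 0b b))))
    where
    c = a ++ replicate k 0b
    eq₀ : word w ≡ c ++ 0b ∷ x ++ b
    eq₀ = trans eq (sym (trans (++-assoc a _ _) (cong (a ++_) (replicate-++-∷ k 0b (x ++ b)))))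

dexterEdge⇒≤ᵗ : {w w′ : DyckPath n} → DexterEdge w w′ → w ≤ᵗ w′
dexterEdge⇒≤ᵗ {w = w} {w′} (mkDexterEdge x _ a N zeros _ i _ i≤N target) =
  shift-zeros (factor-arch x) w w′ a (after x) i≤N
    (trans (split x) (trans (cong (_++ factor x ++ after x) zeros) (++-assoc a _ _)))
    target

proposition1p6 : (n : ℕ) (w w′ : DyckPath n) → w ≤ᵈ w′ → w ≤ᵗ w′
proposition1p6 n w w′ = dexterEdge⇒≤ᵗ ⋆
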